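{- There are instances of the uncapacitated preemptive multi-vehicle Dial-a-Ride problem, with arbitrarily large number $t$ of distinct depots, for which the optimal makespan is a factor $\Omega\!\left(\frac{\log t}{\log\log t}\right)$ larger than both of the following lower bounds: (i) $\max_{i\in[m]} d(s_i,t_i)$, and (ii) the optimal value of the nurse-station-location instance with depots $\{r_j\}_{j=1}^q$ and terminals $S\cup T$. That is, the optimal makespan is $\Omega\!\left(\frac{\log t}{\log\log t}\right)$ times the maximum of (i) and (ii), and this maximum is positive.
   Context: A finite metric is a pair $(V,d)$ with $d$ a symmetric distance function satisfying the triangle inequality; distances denote travel times. An instance of multi-vehicle Dial-a-Ride consists of an $n$-vertex metric $(V,d)$, $m$ objects given by source-destination pairs $\{(s_i,t_i)\}_{i=1}^m$, $q$ vehicles with respective depot vertices $r_1,\dots,r_q\in V$, and a common vehicle capacity $k$. Let $S=\{s_i\mid i\in[m]\}$, $T=\{t_i\mid i\in[m]\}$, and let $t$ be the number of distinct depot vertices. A feasible (preemptive) schedule consists of a route for each vehicle, starting at time $0$, where vehicle $j$ starts and ends at $r_j$, such that no vehicle carries more than $k$ objects at any time and every object is moved from its source to its destination. Vehicles may wait at vertices. Preemption is allowed: an object may be left at any intermediate vertex and later be picked up by the same or another vehicle. The makespan is the maximum over vehicles of the time at which the vehicle returns to its depot at the end of its route; the objective is to minimize it. The uncapacitated problem is the special case $k\ge m$. Nurse-station-location problem: given a metric $(V,d)$, a set $\mathcal{T}\subseteq V$ of terminals and a multiset $\{r_j\}_{j=1}^q$ of depot vertices, find trees $F_1,\dots,F_q$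 that collectively contain all terminals, with $F_j$ rooted at (containing) $r_j$, so as to minimize $\max_{j} d(F_j)$, where $d(F_j)$ is the total length of the edges of $F_j$.
   Formalization: Distances are rational, and the lower bound on the optimal makespan is stated over schedules whose arrival, departure and waiting times are rational rather than real. -}

module Defs where

open import Data.Bool.Base using (Bool; true; false; _∧_; _∨_)
open import Data.Fin.Base as Fin using (Fin; zero; suc; fromℕ; inject₁; toℕ)
import Data.Fin.Properties as Fin
open import Data.Integer.Base using (+_)
open import Data.List.Base using (List; []; _∷_; _++_; map; foldr; length; filterᵇ; allFin; tabulate; deduplicate)
open import Data.List.Membership.Propositional using (_∈_)
open import Data.List.Relation.Unary.Unique.Propositional using (Unique)
open import Data.Nat.Base as ℕ using (ℕ; zero; suc)
import Data.Nat.Properties as ℕ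
open import Data.Nat.Logarithm using (⌊log₂_⌋; ⌈log₂_⌉)
open import Data.Product.Base using (∃; _×_; _,_; uncurry)
open import Data.Rational.Base using (ℚ; 0ℚ; _+_; _/_; _≤_; _⊔_)
open import Data.Sum.Base using (_⊎_)
open import Function.Metric.Rational using (IsMetric)
open import Relation.Binary.PropositionalEquality using (_≡_)
open import Relation.Nullary.Decidable using (does)

sumℚ : List ℚ → ℚ
sumℚ = foldr _+_ 0ℚ

-- The maximum of finitely many rationals.  It is only applied to distances,
-- lengths and arrival times, all nonnegative, so the base value 0 is harmless.
maxℚ : ∀ {n} → (Fin n → ℚ) → ℚ
maxℚ f = foldr _⊔_ 0ℚ (tabulate f)

IsMinimum : {A : Set} → (A → ℚ) → ℚ → Set
IsMinimum {A} cost v = (∃ λ (x : A) → cost x ≡ v) × (∀ (x : A) → v ≤ cost x)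

record FiniteMetric : Set where
  field
    n        : ℕ
    d        : Fin n → Fin n → ℚ
    isMetric : IsMetric _≡_ d

  V : Set
  V = Fin n

record DialARide : Set where
  field
    metric   : FiniteMetric
  open FiniteMetric metric public
  field
    m        : ℕ
    source   : Fin m → V
    target   : Fin m → V
    q        : ℕ
    depot    : Fin q → V
    capacity : ℕ

  Uncapacitated : Set
  Uncapacitated = m ℕ.≤ capacity

  distinctDepots : ℕ
  distinctDepots = length (deduplicate Fin._≟_ (tabulate depot))

  maxDirect : ℚ
  maxDirect = maxℚ λ i → d (source i) (target i)

  Terminal : V → Set
  Terminal v = ∃ λ i → v ≡ source i ⊎ v ≡ target i

module Schedules (I : DialARide) where
  open DialARide I

  -- A closed walk from r: the vehicle is at `stop a` from time `arrive a` to
  -- time `depart a`, and hop number e leads from stop e to stop e + 1.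
  record Route (r : V) : Set where
    field
      hops         : ℕ
      stop         : Fin (suc hops) → V
      arrive       : Fin (suc hops) → ℚ
      depart       : Fin (suc hops) → ℚ
      starts       : stop zero ≡ r
      ends         : stop (fromℕ hops) ≡ r
      startsAt0    : arrive zero ≡ 0ℚ
      waits        : ∀ a → arrive a ≤ depart a
      travels      : ∀ (e : Fin hops) →
                     arrive (suc e) ≡ depart (inject₁ e) + d (stop (inject₁ e)) (stop (suc e))

    finish : ℚ
    finish = arrive (fromℕ hops)

  module _ (route : (j : Fin q) → Route (depot j)) where
    open module R j = Route (route j) using (hops; stop; arrive; depart)

    -- `Journey u τ w`: how an object lying at u at time τ is moved to w.
    -- In each ride it boards vehicle j on departure from stop a and is put down
    -- on arrival at a later stop b, where it may lie until it boards again.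
    data Journey : V → ℚ → V → Set where
      arrived : ∀ {w τ} → Journey w τ w
      ride    : ∀ {w τ} (j : Fin q) (a b : Fin (suc (hops j))) →
                a Fin.< b → τ ≤ depart j a →
                Journey (stop j b) (arrive j b) w →
                Journey (stop j a) τ w

    aboard : ∀ {u τ w} → Journey u τ w → (j : Fin q) → Fin (hops j) → Bool
    aboard arrived                  j e = false
    aboard (ride j′ a b _ _ onward) j e =
      (does (j Fin.≟ j′) ∧ does (toℕ a ℕ.≤? toℕ e) ∧ does (toℕ e ℕ.<? toℕ b))
      ∨ aboard onward j e

  -- Bounding the load on every hop bounds it at all times: objects are put down
  -- on arrival and picked up on departure, so a waiting vehicle holds no object
  -- that it does not also carry on the next hop.
  record Schedule : Set where
    field
      route    : (j : Fin q) → Route (depot j)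
      journey  : (i : Fin m) → Journey route (source i) 0ℚ (target i)
      withinCapacity : ∀ (j : Fin q) (e : Fin (Route.hops (route j))) →
        length (filterᵇ (λ i → aboard route (journey i) j e) (allFin m)) ℕ.≤ capacity

  makespan : Schedule → ℚ
  makespan σ = maxℚ λ j → Route.finish (Schedule.route σ j)

open Schedules public using (Schedule; makespan)

data RootedTree (A : Set) : Set where
  node : A → List (RootedTree A) → RootedTree A

module _ {A : Set} where

  root : RootedTree A → A
  root (node x _) = x

  vertices  : RootedTree A → List A
  vertices* : List (RootedTree A) → List A
  vertices (node x ts) = x ∷ vertices* ts
  vertices* []       = []
  vertices* (t ∷ ts) = vertices t ++ vertices* ts

  edges  : RootedTree A → List (A × A)
  edges* : A → List (RootedTree A) → List (A × A)
  edges (node x ts) = edges* x ts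
  edges* x []       = []
  edges* x (t ∷ ts) = (x , root t) ∷ edges t ++ edges* x ts

module NurseStationLocation
  (M : FiniteMetric) (Terminal : FiniteMetric.V M → Set)
  {q : ℕ} (depot : Fin q → FiniteMetric.V M) where
  open FiniteMetric M

  -- `distinct` makes each F j a tree in the complete graph on V: no vertex is
  -- repeated.  Taking the root to be the depot loses no generality, since a
  -- tree containing a vertex can be rooted there.
  record Solution : Set where
    field
      F        : Fin q → RootedTree V
      distinct : ∀ j → Unique (vertices (F j))
      rooted   : ∀ j → root (F j) ≡ depot j
      covers   : ∀ v → Terminal v → ∃ λ j → v ∈ vertices (F j)

  treeLength : RootedTree V → ℚ
  treeLength t = sumℚ (map (uncurry d) (edges t))

  cost : Solution → ℚ
  cost S = maxℚ λ j → treeLength (Solution.F S j)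

IsNurseStationOptimum : DialARide → ℚ → Set
IsNurseStationOptimum I = IsMinimum (NurseStationLocation.cost metric Terminal depot)
  where open DialARide I

-- "The minimum makespan is at least b".  `Schedule I` ensures that the minimum
-- is over a nonempty set, so that the bound is not vacuous.
OptimalMakespan≥ : DialARide → ℚ → Set
OptimalMakespan≥ I b = Schedule I × (∀ (σ : Schedule I) → b ≤ makespan I σ)

-- log t / log log t in base 2, with the numerator rounded up and the denominator
-- rounded down.  For t ≥ 4 this is at least the real quotient and at most a
-- constant multiple of it, so as a growth rate the two agree.
logRatio : (t : ℕ) → .{{ℕ.NonZero ⌊log₂ ⌊log₂ t ⌋ ⌋}} → ℚ
logRatio t = + ⌈log₂ t ⌉ / ⌊log₂ ⌊log₂ t ⌋ ⌋

{-# OPTIONS --safe #-}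
-- Take a graph on n = K^O(K) vertices with n K unit-length edges in which every
-- cycle has more than K edges, a depot at every vertex, and one object per edge,
-- to be moved between its endpoints.  Both lower bounds are at most 1.  If every
-- vehicle travels less than K, some edge is never used; its object must go
-- round a cycle through that edge, which takes time at least K.
--
-- Such a graph arises greedily: as long as there are fewer than n K edges, fewer
-- than half of the vertices have degree at least 4 K, while a ball of radius
-- K - 1 contains at most (4 K + 1)^(K - 1) ≤ n / 2 vertices, so two vertices of
-- low degree at distance at least K can be joined.
module Submission where

open import Defs
open import Data.Bool.Base using (true; false; if_then_else_)
open import Data.Fin.Base as Fin using (Fin; zero; suc; fromℕ; inject₁)
import Data.Fin.Properties as Fin
open import Data.Fin.Relation.Unary.Top using (view; ‵fromℕ; ‵inject₁; view-fromℕ; view-inject₁)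
import Data.Integer.Base as ℤ
import Data.Integer.Properties as ℤ
open import Data.List.Base using (List; []; _∷_; _++_; map; length; lookup; filter; concat; concatMap; tabulate; removeAt; allFin)
open import Data.List.Properties using (length-++; length-map; length-tabulate; length-filter; length-deduplicate; filter-reject)
import Data.List.Membership.DecPropositional as DecMembership
open import Data.List.Membership.Propositional using (_∈_; _∉_; lose)
open import Data.List.Membership.Propositional.Properties using (∈-map⁺; ∈-++⁺ˡ; ∈-++⁺ʳ; ∈-filter⁺; ∈-concat⁺′; ∈-concatMap⁺; ∈-tabulate⁺; ∈-allFin; ∈-deduplicate⁺)
open import Data.List.Membership.Setoid.Properties using (index-injective)
open import Data.List.Relation.Unary.All using (All; []; _∷_; universal)
open import Data.List.Relation.Unary.All.Properties using (all-filter; map⁺; tabulate⁺)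
open import Data.List.Relation.Unary.AllPairs using ([]; _∷_)
open import Data.List.Relation.Unary.Any using (here; there; index)
open import Data.List.Relation.Unary.Unique.Propositional using (Unique)
open import Data.List.Relation.Unary.Unique.Propositional.Properties using (allFin⁺; filter⁺)
open import Data.Nat.Base as ℕ using (ℕ; zero; suc; z≤n; s≤s)
import Data.Nat.Properties as ℕ
open import Data.Nat.ListAction using (sum)
open import Data.Nat.Logarithm using (⌊log₂_⌋; ⌈log₂_⌉; ⌊log₂⌋-mono-≤; ⌊log₂[2^n]⌋≡n; ⌈log₂2^n⌉≡n)
open import Data.Nat.Tactic.RingSolver using (solve-∀)
open import Data.Product.Base using (Σ-syntax; ∃-syntax; ∃₂; _×_; _,_; proj₁; proj₂)
open import Data.Sum.Base using (inj₁; inj₂)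
open import Function.Base using (_∘_; id)
open import Function.Metric.Rational using (IsMetric)
open import Relation.Binary.PropositionalEquality
open import Relation.Nullary using (¬_; yes; no; contradiction)
open import Relation.Nullary.Decidable using (does; _×-dec_)

-- Counting with lists.

covering⇒≤length : ∀ {n} {xs : List (Fin n)} → (∀ y → y ∈ xs) → n ℕ.≤ length xs
covering⇒≤length all∈xs =
  Fin.injective⇒≤ {f = index ∘ all∈xs} (index-injective (setoid _) (all∈xs _) (all∈xs _))

length-concat-≤ : ∀ {A : Set} {c} {xss : List (List A)} → All (λ xs → length xs ℕ.≤ c) xss →
                  length (concat xss) ℕ.≤ length xss ℕ.* c
length-concat-≤ [] = z≤n
length-concat-≤ {xss = xs ∷ xss} (xs≤c ∷ xss≤c) rewrite length-++ xs {concat xss} =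
  ℕ.+-mono-≤ xs≤c (length-concat-≤ xss≤c)

-- Truncated graph distance, built edge by edge.

module Relaxation {n : ℕ} (K : ℕ) where
  open import Data.Nat.Base
  open import Data.Nat.Properties

  Edge : Set
  Edge = Fin n × Fin n

  -- Edges are undirected but stored as ordered pairs. An `Arc` is a direction of traversal, so that
  -- one argument serves both directions.
  data Arc : Edge → Fin n → Fin n → Set where
    forward  : ∀ {a b} → Arc (a , b) a b
    backward : ∀ {a b} → Arc (a , b) b a

  reverse : ∀ {e p q} → Arc e p q → Arc e q p
  reverse forward  = backward
  reverse backward = forward

  -- The length of a shortest path, truncated at K.  Adding the edges one at a time
  -- replaces every argument about paths by an induction over the edges.
  dist : List Edge → Fin n → Fin n → ℕ
  dist []             x y = if does (x Fin.≟ y) then 0 else K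
  dist ((a , b) ∷ es) x y =
    dist es x y ⊓ ((dist es x a + suc (dist es b y)) ⊓ (dist es x b + suc (dist es a y)))

  dist-skip : ∀ e es x y → dist (e ∷ es) x y ≤ dist es x y
  dist-skip e es x y = m⊓n≤m _ _

  dist-via : ∀ {e p q} es x y → Arc e p q →
             dist (e ∷ es) x y ≤ dist es x p + suc (dist es q y)
  dist-via es x y forward  = ≤-trans (m⊓n≤n (dist es x y) _) (m⊓n≤m _ _)
  dist-via es x y backward = ≤-trans (m⊓n≤n (dist es x y) _) (m⊓n≤n _ _)

  -- Records which term attains the minimum in `dist`: a shortest path avoids the newest edge or
  -- crosses it once, in a definite direction.
  data Shortest e es x y : Set where
    skip : dist (e ∷ es) x y ≡ dist es x y → Shortest e es x y
    via  : ∀ {p q} → Arc e p q → dist (e ∷ es) x y ≡ dist es x p + suc (dist es q y) →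
           Shortest e es x y

  shortest : ∀ e es x y → Shortest e es x y
  shortest (a , b) es x y
    with ⊓-sel (dist es x y) ((dist es x a + suc (dist es b y)) ⊓ (dist es x b + suc (dist es a y)))
  ... | inj₁ eq = skip eq
  ... | inj₂ eq with ⊓-sel (dist es x a + suc (dist es b y)) (dist es x b + suc (dist es a y))
  ...   | inj₁ eq′ = via forward (trans eq eq′)
  ...   | inj₂ eq′ = via backward (trans eq eq′)

  dist-refl : ∀ es x → dist es x x ≡ 0
  dist-refl [] x with x Fin.≟ x
  ... | yes _   = refl
  ... | no  x≢x = contradiction refl x≢x
  dist-refl (e ∷ es) x = n≤0⇒n≡0 (≤-trans (dist-skip e es x x) (≤-reflexive (dist-refl es x)))

  dist-sym-≤ : ∀ es x y → dist es x y ≤ dist es y x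
  dist-sym-≤ [] x y with x Fin.≟ y | y Fin.≟ x
  ... | yes _   | _       = z≤n
  ... | no  x≢y | yes y≡x = contradiction (sym y≡x) x≢y
  ... | no  _   | no  _   = ≤-refl
  dist-sym-≤ (e ∷ es) x y with shortest e es y x
  ... | skip eq rewrite eq = ≤-trans (dist-skip e es x y) (dist-sym-≤ es x y)
  ... | via {p} {q} arc eq rewrite eq = begin
    dist (e ∷ es) x y                ≤⟨ dist-via es x y (reverse arc) ⟩
    dist es x q + suc (dist es p y)  ≤⟨ +-mono-≤ (dist-sym-≤ es x q) (s≤s (dist-sym-≤ es p y)) ⟩
    dist es q x + suc (dist es y p)  ≡⟨ solve (dist es q x) (dist es y p) ⟩
    dist es y p + suc (dist es q x)  ∎
    where
    open ≤-Reasoning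
    solve : ∀ m n → m + suc n ≡ n + suc m
    solve = solve-∀

  dist-sym : ∀ es x y → dist es x y ≡ dist es y x
  dist-sym es x y = ≤-antisym (dist-sym-≤ es x y) (dist-sym-≤ es y x)

  -- The delicate case has both paths crossing the new edge. In the same direction, the detour
  -- between the crossings is cut out and one crossing remains. In opposite directions, both
  -- crossings are cut out, leaving a walk from x through p to z in the old graph.
  dist-triangle : ∀ es x y z → dist es x z ≤ dist es x y + dist es y z
  dist-triangle [] x y z with x Fin.≟ y | y Fin.≟ z | x Fin.≟ z
  ... | _        | _        | yes _   = z≤n
  ... | yes refl | yes refl | no x≢x = contradiction refl x≢x
  ... | no _     | _        | no _   = m≤m+n K _
  ... | yes _    | no _     | no _   = ≤-refl
  dist-triangle (e ∷ es) x y z with shortest e es x y | shortest e es y z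
  ... | skip eq₁ | skip eq₂ rewrite eq₁ | eq₂ =
    ≤-trans (dist-skip e es x z) (dist-triangle es x y z)
  ... | skip eq₁ | via {p} {q} arc eq₂ rewrite eq₁ | eq₂ = begin
    dist (e ∷ es) x z                                ≤⟨ dist-via es x z arc ⟩
    dist es x p + suc (dist es q z)                  ≤⟨ +-monoˡ-≤ _ (dist-triangle es x y p) ⟩
    dist es x y + dist es y p + suc (dist es q z)    ≡⟨ +-assoc (dist es x y) _ _ ⟩
    dist es x y + (dist es y p + suc (dist es q z))  ∎
    where open ≤-Reasoning
  ... | via {p} {q} arc eq₁ | skip eq₂ rewrite eq₁ | eq₂ = begin
    dist (e ∷ es) x z                                ≤⟨ dist-via es x z arc ⟩
    dist es x p + suc (dist es q z)                  ≤⟨ +-monoʳ-≤ (dist es x p) (s≤s (dist-triangle es q y z)) ⟩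
    dist es x p + (suc (dist es q y) + dist es y z)  ≡⟨ +-assoc (dist es x p) _ _ ⟨
    dist es x p + suc (dist es q y) + dist es y z    ∎
    where open ≤-Reasoning
  ... | via {p} {q} arc₁ eq₁ | via arc₂ eq₂ rewrite eq₁ | eq₂ = twice arc₁ arc₂
    where
    open ≤-Reasoning
    twice : ∀ {p q p′ q′} → Arc e p q → Arc e p′ q′ → dist (e ∷ es) x z ≤
            dist es x p + suc (dist es q y) + (dist es y p′ + suc (dist es q′ z))
    same : ∀ {p q} → Arc e p q → dist (e ∷ es) x z ≤
           dist es x p + suc (dist es q y) + (dist es y p + suc (dist es q z))
    same {p} {q} arc = begin
      dist (e ∷ es) x z                ≤⟨ dist-via es x z arc ⟩
      dist es x p + suc (dist es q z)  ≤⟨ +-mono-≤ (m≤m+n (dist es x p) _) (m≤n+m _ (dist es y p)) ⟩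
      _                                ∎
    opposite : ∀ {p q} → Arc e p q → dist (e ∷ es) x z ≤
           dist es x p + suc (dist es q y) + (dist es y q + suc (dist es p z))
    opposite {p} {q} arc = begin
      dist (e ∷ es) x z          ≤⟨ dist-skip e es x z ⟩
      dist es x z                ≤⟨ dist-triangle es x p z ⟩
      dist es x p + dist es p z  ≤⟨ +-mono-≤ (m≤m+n (dist es x p) _)
                                      (≤-trans (n≤1+n _) (m≤n+m _ (dist es y q))) ⟩
      _                          ∎
    twice forward  forward  = same forward
    twice backward backward = same backward
    twice forward  backward = opposite forward
    twice backward forward  = opposite backward

  removal : ∀ es i x y → dist es x y ≤ dist (removeAt es i) x y
  removal (e ∷ es) zero    x y = dist-skip e es x y
  removal (e ∷ es) (suc i) x y with shortest e (removeAt es i) x y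
  ... | skip eq rewrite eq = ≤-trans (dist-skip e es x y) (removal es i x y)
  ... | via {p} {q} arc eq rewrite eq =
    ≤-trans (dist-via es x y arc) (+-mono-≤ (removal es i x p) (s≤s (removal es i q y)))

  -- `is` lists the edges of a shortest path from x to y.
  geodesic : ∀ es x y → ∃[ is ] (length is ≤ dist es x y ×
             (∀ i → i ∉ is → dist (removeAt es i) x y ≤ dist es x y))
  geodesic [] x y = [] , z≤n , λ ()
  geodesic (e ∷ es) x y with shortest e es x y
  ... | skip eq rewrite eq =
    let is , is≤ , avoid = geodesic es x y in
    map suc is , ≤-trans (≤-reflexive (length-map suc is)) is≤ , λ where
      zero    _   → ≤-refl
      (suc i) i∉ → ≤-trans (dist-skip e (removeAt es i) x y) (avoid i (i∉ ∘ ∈-map⁺ suc))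
  ... | via {p} {q} arc eq rewrite eq =
    let is , is≤ , avoidIs = geodesic es x p
        js , js≤ , avoidJs = geodesic es q y
    in map suc is ++ zero ∷ map suc js
     , ≤-trans (≤-reflexive (trans (length-++ (map suc is))
         (cong₂ (λ m n → m + suc n) (length-map suc is) (length-map suc js))))
         (+-mono-≤ is≤ (s≤s js≤))
     , λ where
      zero    i∉ → contradiction (∈-++⁺ʳ (map suc is) (here refl)) i∉
      (suc i) i∉ → ≤-trans (dist-via (removeAt es i) x y arc) (+-mono-≤
        (avoidIs i (i∉ ∘ ∈-++⁺ˡ ∘ ∈-map⁺ suc))
        (s≤s (avoidJs i (i∉ ∘ ∈-++⁺ʳ (map suc is) ∘ there ∘ ∈-map⁺ suc))))

  -- Girth and its preservation under new edges.

  tail head : (es : List Edge) → Fin (length es) → Fin n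
  tail es i = proj₁ (lookup es i)
  head es i = proj₂ (lookup es i)

  -- An edge together with a path of length at least K around it is a cycle of
  -- length more than K.
  Girth : List Edge → Set
  Girth es = ∀ i → K ≤ dist (removeAt es i) (tail es i) (head es i)

  dist-edge : ∀ es i → dist es (tail es i) (head es i) ≤ 1
  dist-edge ((a , b) ∷ es) zero = begin
    dist ((a , b) ∷ es) a b          ≤⟨ dist-via es a b forward ⟩
    dist es a a + suc (dist es b b)  ≡⟨ cong₂ (λ m n → m + suc n) (dist-refl es a) (dist-refl es b) ⟩
    1                                ∎
    where open ≤-Reasoning
  dist-edge (e ∷ es) (suc i) = ≤-trans (dist-skip e es _ _) (dist-edge es i)

  -- If a path around the old edge uv runs through the new edge pq, then the rest of
  -- it together with uv is a path from p to q, so that already p and q are far.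
  girth-extend : ∀ {e} es → Girth es → K ≤ dist es (proj₁ e) (proj₂ e) → Girth (e ∷ es)
  girth-extend es girth far zero = far
  girth-extend {e} es girth far (suc i)
    with lookup es i | girth i | dist-edge es i
  ... | u , v | K≤ | short with shortest e (removeAt es i) u v
  ...   | skip eq rewrite eq = K≤
  ...   | via {p} {q} arc eq rewrite eq = begin
    K                                                ≤⟨ far′ arc ⟩
    dist es p q                                      ≤⟨ dist-triangle es p u q ⟩
    dist es p u + dist es u q                        ≤⟨ +-mono-≤ (dist-sym-≤ es p u) (dist-triangle es u v q) ⟩
    dist es u p + (dist es u v + dist es v q)        ≤⟨ +-monoʳ-≤ _ (+-mono-≤ short (dist-sym-≤ es v q)) ⟩
    dist es u p + suc (dist es q v)                  ≤⟨ +-mono-≤ (removal es i u p) (s≤s (removal es i q v)) ⟩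
    dist (removeAt es i) u p + suc (dist (removeAt es i) q v) ∎
    where
    open ≤-Reasoning
    far′ : ∀ {p q} → Arc e p q → K ≤ dist es p q
    far′ forward  = far
    far′ backward = ≤-trans far (dist-sym-≤ es _ _)

  -- Degrees and the handshake bound.

  arcs : List Edge → List Edge
  arcs []             = []
  arcs ((a , b) ∷ es) = (a , b) ∷ (b , a) ∷ arcs es

  Arc⇒∈arcs : ∀ {e p q} es → Arc e p q → (p , q) ∈ arcs (e ∷ es)
  Arc⇒∈arcs es forward  = here refl
  Arc⇒∈arcs es backward = there (here refl)

  length-arcs : ∀ es → length (arcs es) ≡ length es * 2
  length-arcs []       = refl
  length-arcs (e ∷ es) = cong (2 +_) (length-arcs es)

  outgoing : List Edge → Fin n → List Edge
  outgoing as z = filter (λ a → proj₁ a Fin.≟ z) as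

  outgoing-reject : ∀ {p q z} as → p ≢ z →
                    length (outgoing ((p , q) ∷ as) z) ≡ length (outgoing as z)
  outgoing-reject as p≢z = cong length (filter-reject (λ a → proj₁ a Fin.≟ _) {xs = as} p≢z)

  neighbours : List Edge → Fin n → List (Fin n)
  neighbours es z = map proj₂ (outgoing (arcs es) z)

  degree : List Edge → Fin n → ℕ
  degree es z = length (outgoing (arcs es) z)

  ∈-neighbours⁺ : ∀ {z y} es → (z , y) ∈ arcs es → y ∈ neighbours es z
  ∈-neighbours⁺ es zy∈ = ∈-map⁺ proj₂ (∈-filter⁺ _ zy∈ refl)

  outgoing-monoʳ : ∀ {z y} a as → y ∈ map proj₂ (outgoing as z) → y ∈ map proj₂ (outgoing (a ∷ as) z)
  outgoing-monoʳ {z} a as y∈ with does (proj₁ a Fin.≟ z)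
  ... | true  = there y∈
  ... | false = y∈

  neighbours-monoʳ : ∀ {z y} e es → y ∈ neighbours es z → y ∈ neighbours (e ∷ es) z
  neighbours-monoʳ (a , b) es y∈ =
    outgoing-monoʳ (a , b) _ (outgoing-monoʳ (b , a) (arcs es) y∈)

  closed-monoʳ : ∀ {z y} e es → y ∈ z ∷ neighbours es z → y ∈ z ∷ neighbours (e ∷ es) z
  closed-monoʳ e es (here eq)  = here eq
  closed-monoʳ e es (there y∈) = there (neighbours-monoʳ e es y∈)

  -- The new arc is counted only at its start p, and p occurs at most once in `zs`.
  sum-outgoing-∷ : ∀ p q as {zs} → Unique zs →
    sum (map (length ∘ outgoing ((p , q) ∷ as)) zs) ≤ suc (sum (map (length ∘ outgoing as) zs))
  sum-outgoing-∷ p q as [] = z≤n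
  sum-outgoing-∷ p q as {z ∷ zs} (z∉zs ∷ uniq) with p Fin.≟ z
  ... | no p≢z = ≤-trans (+-monoʳ-≤ (length (outgoing as z)) (sum-outgoing-∷ p q as uniq))
                         (≤-reflexive (+-suc _ _))
  ... | yes refl = s≤s (+-monoʳ-≤ (length (outgoing as z)) (≤-reflexive (unaffected z∉zs)))
    where
    unaffected : ∀ {zs} → All (p ≢_) zs →
      sum (map (length ∘ outgoing ((p , q) ∷ as)) zs) ≡ sum (map (length ∘ outgoing as) zs)
    unaffected []           = refl
    unaffected (p≢z ∷ p≢zs) = cong₂ _+_ (outgoing-reject as p≢z) (unaffected p≢zs)

  sum-outgoing-≤ : ∀ as {zs} → Unique zs → sum (map (length ∘ outgoing as) zs) ≤ length as
  sum-outgoing-≤ [] {zs} _ = ≤-reflexive (zeros zs)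
    where
    zeros : ∀ zs → sum (map (length ∘ outgoing []) zs) ≡ 0
    zeros []       = refl
    zeros (_ ∷ zs) = zeros zs
  sum-outgoing-≤ ((p , q) ∷ as) uniq =
    ≤-trans (sum-outgoing-∷ p q as uniq) (s≤s (sum-outgoing-≤ as uniq))

  high : ℕ → List Edge → List (Fin n)
  high D es = filter (λ z → D ≤? degree es z) (allFin n)

  ∈-high⁺ : ∀ {D z} es → D ≤ degree es z → z ∈ high D es
  ∈-high⁺ {D} es = ∈-filter⁺ (λ z → D ≤? degree es z) (∈-allFin _)

  -- Handshaking: each edge gives two arcs, each counted at most once in the degree sum over the
  -- high vertices, while every such vertex contributes at least D.
  length-high : ∀ D es → length (high D es) * D ≤ length es * 2
  length-high D es = begin
    length (high D es) * D               ≤⟨ sum-lower-bound (all-filter _ (allFin n)) ⟩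
    sum (map (degree es) (high D es))    ≤⟨ sum-outgoing-≤ (arcs es) (filter⁺ _ (allFin⁺ n)) ⟩
    length (arcs es)                     ≡⟨ length-arcs es ⟩
    length es * 2                        ∎
    where
    open ≤-Reasoning
    sum-lower-bound : ∀ {zs} → All (λ z → D ≤ degree es z) zs → length zs * D ≤ sum (map (degree es) zs)
    sum-lower-bound []         = z≤n
    sum-lower-bound (d≥ ∷ ds≥) = +-mono-≤ d≥ (sum-lower-bound ds≥)

  -- Balls and their growth.

  -- Vertices may be repeated; only an upper bound on the size is wanted. Closed neighbourhoods make
  -- the balls increase with the radius.
  ball : List Edge → ℕ → Fin n → List (Fin n)
  ball es zero    x = x ∷ []
  ball es (suc r) x = concatMap (λ z → z ∷ neighbours es z) (ball es r x)

  BoundedDegree : ℕ → List Edge → Set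
  BoundedDegree D es = ∀ z → degree es z ≤ D

  length-ball : ∀ {D} es → BoundedDegree D es → ∀ r x → length (ball es r x) ≤ suc D ^ r
  length-ball es deg zero    x = ≤-refl
  length-ball {D} es deg (suc r) x = begin
    length (ball es (suc r) x)                 ≤⟨ length-concat-≤ (map⁺ (universal closed≤ (ball es r x))) ⟩
    length (map closed (ball es r x)) * suc D  ≡⟨ cong (_* suc D) (length-map closed (ball es r x)) ⟩
    length (ball es r x) * suc D               ≤⟨ *-monoˡ-≤ (suc D) (length-ball es deg r x) ⟩
    suc D ^ r * suc D                          ≡⟨ *-comm (suc D ^ r) (suc D) ⟩
    suc D ^ suc r                              ∎
    where
    open ≤-Reasoning
    closed : Fin n → List (Fin n)
    closed z = z ∷ neighbours es z
    closed≤ : ∀ z → length (closed z) ≤ suc D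
    closed≤ z rewrite length-map proj₂ (outgoing (arcs es) z) = s≤s (deg z)

  module _ .{{_ : NonZero K}} where
    dist≡0⇒≡ : ∀ es {x y} → dist es x y ≡ 0 → x ≡ y
    dist≡0⇒≡ [] {x} {y} eq with x Fin.≟ y
    ... | yes x≡y = x≡y
    ... | no  _   = contradiction eq (≢-nonZero⁻¹ K)
    dist≡0⇒≡ (e ∷ es) {x} {y} eq with shortest e es x y
    ... | skip eq′ = dist≡0⇒≡ es (trans (sym eq′) eq)
    ... | via {p} arc eq′ with () ← trans (sym (+-suc (dist es x p) _)) (trans (sym eq′) eq)

    -- The vertex z is the last but one on a shortest path, or y itself if the path is trivial. The
    -- bound below K ensures that the distance comes from a path and not from the default value K.
    lastStep : ∀ {r} es x y → suc r < K → dist es x y ≤ suc r →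
               ∃[ z ] (dist es x z ≤ r × y ∈ z ∷ neighbours es z)
    lastStep [] x y r<K d≤ with x Fin.≟ y
    ... | yes refl = x , ≤-trans (≤-reflexive (dist-refl [] x)) z≤n , here refl
    ... | no  _    = contradiction d≤ (<⇒≱ r<K)
    lastStep {r} (e ∷ es) x y r<K d≤ with shortest e es x y
    ... | skip eq =
      let z , d≤r , y∈ = lastStep es x y r<K (subst (_≤ _) eq d≤)
      in z , ≤-trans (dist-skip e es x z) d≤r , closed-monoʳ e es y∈
    ... | via {p} {q} arc eq with dist es q y in d≡
    -- The path ends at q, so the new edge is its last step and z is p.
    ...   | zero with refl ← dist≡0⇒≡ es {q} {y} d≡ =
      p , ≤-trans (dist-skip e es x p) (≤-trans (m≤m+n _ 0) (s≤s⁻¹ bound))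
        , there (∈-neighbours⁺ (e ∷ es) (Arc⇒∈arcs es arc))
      where
      bound : suc (dist es x p + 0) ≤ suc r
      bound = subst (_≤ suc r) (trans eq (+-suc _ 0)) d≤
    ...   | suc s = step
      where
      bound : dist es x p + suc s ≤ r
      bound = s≤s⁻¹ (subst (_≤ suc r) (trans eq (+-suc _ (suc s))) d≤)
      step : ∃[ z ] (dist (e ∷ es) x z ≤ r × y ∈ z ∷ neighbours (e ∷ es) z)
      -- The path goes on after q, so its last step is that of the remainder from q to y, whose
      -- length `suc s` is still below K.
      step with lastStep {s} es q y
                  (≤-<-trans (m≤n+m (suc s) (dist es x p)) (≤-<-trans bound (<-trans (n<1+n r) r<K)))
                  (≤-reflexive d≡)
      ... | z , d≤s , y∈ =
        z , ≤-trans (dist-via es x z arc) (≤-trans (+-monoʳ-≤ (dist es x p) (s≤s d≤s)) bound)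
          , closed-monoʳ e es y∈

    -- Induction on the radius, peeling off the last step of a shortest path.
    ∈-ball : ∀ es r {x y} → r < K → dist es x y ≤ r → y ∈ ball es r x
    ∈-ball es zero {x} {y} r<K d≤0 = here (sym (dist≡0⇒≡ es (n≤0⇒n≡0 d≤0)))
    ∈-ball es (suc r) {x} {y} r<K d≤ =
      let z , d≤r , y∈ = lastStep es x y r<K d≤
      in ∈-concatMap⁺ _ (lose (∈-ball es r (<-trans (n<1+n r) r<K) d≤r) y∈)

    -- Each endpoint gains exactly one arc, since a and b differ; a loop would add two to the degree
    -- of its vertex.
    bounded-extend : ∀ {D a b} es → BoundedDegree D es → degree es a < D → degree es b < D →
                     a ≢ b → BoundedDegree D ((a , b) ∷ es)
    bounded-extend {a = a} {b} es deg a<D b<D a≢b z with a Fin.≟ z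
    ... | yes refl = subst (_< _) (sym (outgoing-reject (arcs es) (a≢b ∘ sym))) a<D
    ... | no  _ with b Fin.≟ z
    ...   | yes refl = b<D
    ...   | no  _    = deg z

    -- Greedy construction of a dense graph of large girth.

    module Greedy (large : 2 * suc (4 * K) ^ pred K ≤ n) where
      D : ℕ
      D = 4 * K

      -- By `large`, `zs` covers at most n / 2 vertices, so at least n / 2 would have degree at
      -- least 4 K. By handshaking that takes n K edges.
      uncovered : ∀ es → BoundedDegree D es → length es < n * K →
                  ∀ {zs} → length zs ≤ suc D ^ pred K → ¬ (∀ y → y ∈ high D es ++ zs)
      uncovered es deg small {zs} zs≤ all∈ = <-irrefl refl (begin-strict
        n * K * 2            ≤⟨ *-monoˡ-≤ 2 (*-monoˡ-≤ K n≤2h) ⟩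
        h * 2 * K * 2        ≡⟨ rearrange h K ⟩
        h * D                ≤⟨ length-high D es ⟩
        length es * 2        <⟨ *-monoˡ-< 2 small ⟩
        n * K * 2            ∎)
        where
        open ≤-Reasoning
        h b : ℕ
        h = length (high D es)
        b = length zs
        rearrange : ∀ h K → h * 2 * K * 2 ≡ h * (4 * K)
        rearrange = solve-∀
        double : ∀ h b → 2 * (h + b) ≡ 2 * b + h * 2
        double = solve-∀
        -- Everything is doubled to avoid halving n; one of two copies of n then pays for `zs`.
        n≤2h : n ≤ h * 2
        n≤2h = +-cancelˡ-≤ n _ _ (begin
          n + n                         ≡⟨ cong (n +_) (+-identityʳ n) ⟨
          2 * n                         ≤⟨ *-monoʳ-≤ 2 (covering⇒≤length all∈) ⟩
          2 * length (high D es ++ zs)  ≡⟨ cong (2 *_) (length-++ (high D es)) ⟩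
          2 * (h + b)                   ≡⟨ double h b ⟩
          2 * b + h * 2                 ≤⟨ +-monoˡ-≤ (h * 2) (*-monoʳ-≤ 2 zs≤) ⟩
          2 * suc D ^ pred K + h * 2    ≤⟨ +-monoˡ-≤ (h * 2) large ⟩
          n + h * 2                     ∎)

      -- `uncovered` is applied twice: with the empty list it yields a vertex x of low degree, and
      -- with the ball of radius K - 1 around x it yields a low vertex y outside that ball.
      farPair : ∀ es → BoundedDegree D es → length es < n * K →
                ∃₂ λ x y → degree es x < D × degree es y < D × K ≤ dist es x y
      farPair es deg small
        with Fin.any? (λ x → degree es x <? D)
      ... | no  none = contradiction
        (λ y → ∈-++⁺ˡ (∈-high⁺ es (≮⇒≥ λ low → none (y , low))))
        (uncovered es deg small {[]} z≤n)
      ... | yes (x , x-low)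
        with Fin.any? (λ y → (degree es y <? D) ×-dec (K ≤? dist es x y))
      ...   | yes (y , y-low , far) = x , y , x-low , y-low , far
      ...   | no  none = contradiction covered (uncovered es deg small (length-ball es deg (pred K) x))
        where
        covered : ∀ y → y ∈ high D es ++ ball es (pred K) x
        covered y with degree es y <? D
        ... | no  y-high = ∈-++⁺ˡ (∈-high⁺ es (≮⇒≥ y-high))
        ... | yes y-low  = ∈-++⁺ʳ (high D es) (∈-ball es (pred K) (≤-reflexive (suc-pred K))
                             (s≤s⁻¹ (subst (dist es x y <_) (sym (suc-pred K))
                               (≰⇒> λ far → none (y , y-low , far)))))

      graph : ∀ m → m ≤ n * K → ∃[ es ] (length es ≡ m × BoundedDegree D es × Girth es)
      graph zero    _  = [] , refl , (λ _ → z≤n) , λ ()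
      graph (suc m) m< with es , refl , deg , girth ← graph m (<⇒≤ m<)
                       with x , y , x-low , y-low , far ← farPair es deg m< =
        (x , y) ∷ es , refl ,
        bounded-extend es deg x-low y-low
          -- The new edge is no loop: its endpoints are at distance at least K, which is positive.
          (λ { refl → <⇒≱ (>-nonZero⁻¹ K) (≤-trans far (≤-reflexive (dist-refl es x))) }) ,
        girth-extend es girth far

open import Data.Rational.Base using (ℚ; 0ℚ; 1ℚ; _<_; _≤_; _+_; _*_; _/_; _⊔_; toℚᵘ; nonNegative)
open import Data.Rational.Properties
import Data.Rational.Unnormalised.Base as ℚᵘ
import Data.Rational.Unnormalised.Properties as ℚᵘ
open DialARide using (Uncapacitated; distinctDepots; maxDirect)

-- Naturals as rationals, maxima, and telescoping.

toℚ : ℕ → ℚ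
toℚ n = ℤ.+ n / 1

toℚᵘ∘toℚ : ∀ n → toℚᵘ (toℚ n) ℚᵘ.≃ ℚᵘ.mkℚᵘ (ℤ.+ n) 0
toℚᵘ∘toℚ n = toℚᵘ-fromℚᵘ (ℚᵘ.mkℚᵘ (ℤ.+ n) 0)

toℚ-+ : ∀ m n → toℚ (m ℕ.+ n) ≡ toℚ m + toℚ n
toℚ-+ m n = toℚᵘ-injective (begin-equality
  toℚᵘ (toℚ (m ℕ.+ n))                         ≃⟨ toℚᵘ∘toℚ (m ℕ.+ n) ⟩
  ℚᵘ.mkℚᵘ (ℤ.+ (m ℕ.+ n)) 0                       ≃⟨ ℚᵘ.*≡* (cong (ℤ._* ℤ.+ 1) numerators) ⟩
  ℚᵘ.mkℚᵘ (ℤ.+ m) 0 ℚᵘ.+ ℚᵘ.mkℚᵘ (ℤ.+ n) 0          ≃⟨ ℚᵘ.+-cong (toℚᵘ∘toℚ m) (toℚᵘ∘toℚ n) ⟨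
  toℚᵘ (toℚ m) ℚᵘ.+ toℚᵘ (toℚ n)               ≃⟨ toℚᵘ-homo-+ (toℚ m) (toℚ n) ⟨
  toℚᵘ (toℚ m + toℚ n)                         ∎)
  where
  open ℚᵘ.≤-Reasoning
  numerators : ℤ.+ (m ℕ.+ n) ≡ ℤ.+ m ℤ.* ℤ.+ 1 ℤ.+ ℤ.+ n ℤ.* ℤ.+ 1
  numerators = sym (cong₂ ℤ._+_ (ℤ.*-identityʳ (ℤ.+ m)) (ℤ.*-identityʳ (ℤ.+ n)))

toℚ-mono-≤ : ∀ {m n} → m ℕ.≤ n → toℚ m ≤ toℚ n
toℚ-mono-≤ {m} {n} m≤n = toℚᵘ-cancel-≤ (begin
  toℚᵘ (toℚ m)     ≃⟨ toℚᵘ∘toℚ m ⟩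
  ℚᵘ.mkℚᵘ (ℤ.+ m) 0  ≤⟨ ℚᵘ.*≤* (ℤ.*-monoʳ-≤-nonNeg (ℤ.+ 1) (ℤ.+≤+ m≤n)) ⟩
  ℚᵘ.mkℚᵘ (ℤ.+ n) 0  ≃⟨ toℚᵘ∘toℚ n ⟨
  toℚᵘ (toℚ n)     ∎)
  where open ℚᵘ.≤-Reasoning

toℚ-cancel-≤ : ∀ {m n} → toℚ m ≤ toℚ n → m ℕ.≤ n
toℚ-cancel-≤ {m} {n} m≤n
  with ℚᵘ.*≤* m≤n′ ← ℚᵘ.≤-respʳ-≃ (toℚᵘ∘toℚ n) (ℚᵘ.≤-respˡ-≃ (toℚᵘ∘toℚ m) (toℚᵘ-mono-≤ m≤n)) =
  ℤ.drop‿+≤+ (ℤ.*-cancelʳ-≤-pos (ℤ.+ m) (ℤ.+ n) (ℤ.+ 1) m≤n′)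

toℚ-cancel-< : ∀ {m n} → toℚ m < toℚ n → m ℕ.< n
toℚ-cancel-< m<n = ℕ.≰⇒> λ n≤m → <-irrefl refl (<-≤-trans m<n (toℚ-mono-≤ n≤m))

toℚ-nonNeg : ∀ n → 0ℚ ≤ toℚ n
toℚ-nonNeg n = toℚ-mono-≤ {0} {n} z≤n

maxℚ-nonNeg : ∀ {n} (f : Fin n → ℚ) → 0ℚ ≤ maxℚ f
maxℚ-nonNeg {zero}  f = ≤-refl
maxℚ-nonNeg {suc n} f = ≤-trans (maxℚ-nonNeg (f ∘ suc)) (p≤q⊔p (f zero) _)

≤-maxℚ : ∀ {n} (f : Fin n → ℚ) i → f i ≤ maxℚ f
≤-maxℚ f zero    = p≤p⊔q (f zero) _
≤-maxℚ f (suc i) = ≤-trans (≤-maxℚ (f ∘ suc) i) (p≤q⊔p (f zero) _)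

maxℚ-lub : ∀ {n} (f : Fin n → ℚ) {b} → 0ℚ ≤ b → (∀ i → f i ≤ b) → maxℚ f ≤ b
maxℚ-lub {zero}  f 0≤b f≤b = 0≤b
maxℚ-lub {suc n} f 0≤b f≤b = ⊔-lub (f≤b zero) (maxℚ-lub (f ∘ suc) 0≤b (f≤b ∘ suc))

-- Passes from consecutive stops of a route to any two stops in order. The recursion drops the first
-- stop by shifting R, so R has to be arbitrary.
chain : ∀ {h} (R : Fin (suc h) → Fin (suc h) → Set) → (∀ a → R a a) →
        (∀ {a b c} → R a b → R b c → R a c) → (∀ e → R (inject₁ e) (suc e)) →
        ∀ {a b} → a Fin.≤ b → R a b
chain         R r t s {zero}  {zero}  _         = r zero
chain {suc h} R r t s {zero}  {suc b} _         =
  t (s zero) (chain (λ a b → R (suc a) (suc b)) (r ∘ suc) t (s ∘ suc) {zero} {b} z≤n)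
chain {suc h} R r t s {suc a} {suc b} (s≤s a≤b) =
  chain (λ a b → R (suc a) (suc b)) (r ∘ suc) t (s ∘ suc) a≤b

-- The steps telescope. With x the arrival times of a route, the time elapsed pays for every edge
-- charged to its hops.
length-concat-tabulate : ∀ {h} {A : Set} (f : Fin h → List A) (x : Fin (suc h) → ℚ) →
  (∀ e → x (inject₁ e) + toℚ (length (f e)) ≤ x (suc e)) →
  x zero + toℚ (length (concat (tabulate f))) ≤ x (fromℕ h)
length-concat-tabulate {zero}  f x step = ≤-reflexive (+-identityʳ (x zero))
length-concat-tabulate {suc h} f x step = begin
  x zero + toℚ (length (f zero ++ rest))                ≡⟨ cong (λ l → x zero + toℚ l) (length-++ (f zero)) ⟩
  x zero + toℚ (length (f zero) ℕ.+ length rest)        ≡⟨ cong (x zero +_) (toℚ-+ (length (f zero)) (length rest)) ⟩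
  x zero + (toℚ (length (f zero)) + toℚ (length rest))  ≡⟨ +-assoc (x zero) _ _ ⟨
  x zero + toℚ (length (f zero)) + toℚ (length rest)    ≤⟨ +-monoˡ-≤ (toℚ (length rest)) (step zero) ⟩
  x (suc zero) + toℚ (length rest)                      ≤⟨ length-concat-tabulate (f ∘ suc) (x ∘ suc) (step ∘ suc) ⟩
  x (fromℕ (suc h))                                     ∎
  where
  open ≤-Reasoning
  rest = concat (tabulate (f ∘ suc))

-- The Dial-a-Ride instance of a graph, and a feasible schedule.

module Instance {n K : ℕ} .{{_ : ℕ.NonZero K}} (es : List (Fin n × Fin n)) where
  open Relaxation {n} K

  metric : FiniteMetric
  metric = record { n = n ; d = λ x y → toℚ (dist es x y) ; isMetric = isMetric }
    where
    isMetric : IsMetric _≡_ (λ x y → toℚ (dist es x y))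
    isMetric = record
      { isSemiMetric = record
        { isQuasiSemiMetric = record
          { isPreMetric = record
            { isProtoMetric = record
              { isPartialOrder  = ≤-isPartialOrder
              ; ≈-isEquivalence = isEquivalence
              ; cong            = cong₂ (λ x y → toℚ (dist es x y))
              ; nonNegative     = λ {x} {y} → toℚ-nonNeg (dist es x y)
              }
            ; ≈⇒0 = λ { {x} refl → cong toℚ (dist-refl es x) }
            }
          ; 0⇒≈ = λ eq → dist≡0⇒≡ es (ℕ.n≤0⇒n≡0 (toℚ-cancel-≤ (≤-reflexive eq)))
          }
        ; sym = λ x y → cong toℚ (dist-sym es x y)
        }
      ; triangle = λ x y z → ≤-trans (toℚ-mono-≤ (dist-triangle es x y z))
                               (≤-reflexive (toℚ-+ (dist es x y) (dist es y z)))
      }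

  I : DialARide
  I = record
    { metric = metric
    ; m = length es ; source = tail es ; target = head es
    ; q = n ; depot = id
    ; capacity = length es
    }

  distinctDepots≡n : distinctDepots I ≡ n
  distinctDepots≡n = ℕ.≤-antisym
    (ℕ.≤-trans (length-deduplicate Fin._≟_ (allFin n)) (ℕ.≤-reflexive (length-tabulate {n = n} id)))
    (covering⇒≤length (λ v → ∈-deduplicate⁺ Fin._≟_ (∈-allFin v)))

  open Schedules I using (Route; Journey; module Route)
  open Schedules using (arrived; ride)

  -- Vehicle j visits all vertices in order and returns to j.  An object boards the
  -- vehicle that starts at its source.
  tour : Fin n → Fin (suc (suc n)) → Fin n
  tour j zero = j
  tour j (suc a) with view a
  ... | ‵fromℕ     = j
  ... | ‵inject₁ v = v

  tour-end : ∀ j → tour j (fromℕ (suc n)) ≡ j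
  tour-end j rewrite view-fromℕ n = refl

  tour-visits : ∀ j v → tour j (suc (inject₁ v)) ≡ v
  tour-visits j v rewrite view-inject₁ v = refl

  elapsed : ∀ {h} → (Fin (suc h) → Fin n) → Fin (suc h) → ℚ
  elapsed stop zero            = 0ℚ
  elapsed {suc h} stop (suc a) = toℚ (dist es (stop zero) (stop (suc zero))) + elapsed (stop ∘ suc) a

  -- `elapsed` splits off the first hop, whereas a route has to account for the latest one;
  -- associativity passes between the two.
  elapsed-suc : ∀ {h} (stop : Fin (suc h) → Fin n) (e : Fin h) → elapsed stop (suc e) ≡
                elapsed stop (inject₁ e) + toℚ (dist es (stop (inject₁ e)) (stop (suc e)))
  elapsed-suc {suc h} stop zero    = +-comm (toℚ (dist es (stop zero) (stop (suc zero)))) 0ℚ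
  elapsed-suc {suc h} stop (suc e) =
    trans (cong (d₀ +_) (elapsed-suc (stop ∘ suc) e)) (sym (+-assoc d₀ _ _))
    where d₀ = toℚ (dist es (stop zero) (stop (suc zero)))

  tourRoute : ∀ j → Route j
  tourRoute j = record
    { hops      = suc n
    ; stop      = tour j
    ; arrive    = elapsed (tour j)
    ; depart    = elapsed (tour j)
    ; starts    = refl
    ; ends      = tour-end j
    ; startsAt0 = refl
    ; waits     = λ _ → ≤-refl
    ; travels   = elapsed-suc (tour j)
    }

  tourSchedule : Schedule I
  tourSchedule = record
    { route          = tourRoute
    ; journey        = λ i → ride (tail es i) zero (suc (inject₁ (head es i))) (s≤s z≤n) ≤-refl
                         (subst (λ v → Journey tourRoute v
                                         (elapsed (tour (tail es i)) (suc (inject₁ (head es i)))) (head es i))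
                           (sym (tour-visits (tail es i) (head es i))) arrived)
    ; withinCapacity = λ j e → ℕ.≤-trans (length-filter _ (allFin (length es)))
                         (ℕ.≤-reflexive (length-tabulate {n = length es} id))
    }

  -- Lower bound on the makespan.

  module _ (σ : Schedule I) where
    open Schedule σ
    open module R j = Route (route j) using (hops; stop; arrive; depart; finish)

    hopDist : ∀ j → Fin (hops j) → ℕ
    hopDist j e = dist es (stop j (inject₁ e)) (stop j (suc e))

    -- A hop joins arbitrary vertices of the metric rather than the ends of an edge, so it is
    -- charged to the edges of one fixed shortest path.
    usedOnHop : ∀ j → Fin (hops j) → List (Fin (length es))
    usedOnHop j e = proj₁ (geodesic es (stop j (inject₁ e)) (stop j (suc e)))

    used : ∀ j → List (Fin (length es))
    used j = concat (tabulate (usedOnHop j))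

    arrive≤finish : ∀ j a → arrive j a ≤ finish j
    arrive≤finish j a = chain (λ a b → arrive j a ≤ arrive j b) (λ _ → ≤-refl) ≤-trans step (Fin.≤fromℕ a)
      where
      step : ∀ e → arrive j (inject₁ e) ≤ arrive j (suc e)
      step e = begin
        arrive j (inject₁ e)                       ≤⟨ R.waits j (inject₁ e) ⟩
        depart j (inject₁ e)                       ≡⟨ +-identityʳ _ ⟨
        depart j (inject₁ e) + 0ℚ                  ≤⟨ +-monoʳ-≤ (depart j (inject₁ e)) (toℚ-nonNeg (hopDist j e)) ⟩
        depart j (inject₁ e) + toℚ (hopDist j e)   ≡⟨ R.travels j e ⟨
        arrive j (suc e)                           ∎
        where open ≤-Reasoning

    -- Edges have unit length, so a hop takes at least as long as the number of edges charged to it;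
    -- waiting only adds time.
    length-used : ∀ j → toℚ (length (used j)) ≤ finish j
    length-used j = begin
      toℚ (length (used j))                   ≡⟨ +-identityˡ _ ⟨
      0ℚ + toℚ (length (used j))              ≡⟨ cong (_+ toℚ (length (used j))) (R.startsAt0 j) ⟨
      arrive j zero + toℚ (length (used j))   ≤⟨ length-concat-tabulate _ (arrive j) step ⟩
      finish j                                ∎
      where
      open ≤-Reasoning
      step : ∀ e → arrive j (inject₁ e) + toℚ (length (usedOnHop j e)) ≤ arrive j (suc e)
      step e = begin
        arrive j (inject₁ e) + _                   ≤⟨ +-mono-≤ (R.waits j (inject₁ e))
                                                        (toℚ-mono-≤ (proj₁ (proj₂ (geodesic es _ _)))) ⟩
        depart j (inject₁ e) + toℚ (hopDist j e)   ≡⟨ R.travels j e ⟨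
        arrive j (suc e)                           ∎

    module Unused (i : Fin (length es)) (unused : ∀ j → i ∉ used j) where
      D : Fin n → Fin n → ℕ
      D = dist (removeAt es i)

      -- The shortest path chosen for the hop avoids edge i and survives its removal. Hence every
      -- vehicle moves as if in the graph without i.
      D-hop : ∀ j e → D (stop j (inject₁ e)) (stop j (suc e)) ℕ.≤ hopDist j e
      D-hop j e = proj₂ (proj₂ (geodesic es _ _)) i
        λ i∈ → unused j (∈-concat⁺′ i∈ (∈-tabulate⁺ e))

      -- The triangle inequality, in the form that appends a leg from y to z to a travel-time bound
      -- from x to y.
      extend : ∀ s x {y z t} → s + toℚ (D x y) ≤ t → s + toℚ (D x z) ≤ t + toℚ (D y z)
      extend s x {y} {z} {t} s≤t = begin
        s + toℚ (D x z)                  ≤⟨ +-monoʳ-≤ s (toℚ-mono-≤ (dist-triangle (removeAt es i) x y z)) ⟩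
        s + toℚ (D x y ℕ.+ D y z)        ≡⟨ cong (s +_) (toℚ-+ (D x y) (D y z)) ⟩
        s + (toℚ (D x y) + toℚ (D y z))  ≡⟨ +-assoc s _ _ ⟨
        s + toℚ (D x y) + toℚ (D y z)    ≤⟨ +-monoˡ-≤ (toℚ (D y z)) s≤t ⟩
        t + toℚ (D y z)                  ∎
        where open ≤-Reasoning

      rest : ∀ {x s} → s + toℚ (D x x) ≤ s
      rest {x} {s} = ≤-reflexive (trans
        (cong (λ l → s + toℚ l) (dist-refl (removeAt es i) x)) (+-identityʳ s))

      hop≤ : ∀ j e →
        depart j (inject₁ e) + toℚ (D (stop j (inject₁ e)) (stop j (suc e))) ≤ arrive j (suc e)
      hop≤ j e = ≤-trans (+-monoʳ-≤ (depart j (inject₁ e)) (toℚ-mono-≤ (D-hop j e)))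
        (≤-reflexive (sym (R.travels j e)))

      -- The hops are chained from departure to departure, which absorbs the waits. The last hop is
      -- added separately because the ride ends on arrival.
      ride≤ : ∀ j {a b} → a Fin.< b → depart j a + toℚ (D (stop j a) (stop j b)) ≤ arrive j b
      ride≤ j {a} {suc e} (s≤s a≤e) = ≤-trans (extend (depart j a) (stop j a) (chain
        (λ a b → depart j a + toℚ (D (stop j a) (stop j b)) ≤ depart j b)
        (λ _ → rest) (λ {a} ab bc → ≤-trans (extend (depart j a) (stop j a) ab) bc)
        (λ e → ≤-trans (hop≤ j e) (R.waits j (suc e)))
        (subst (_ ℕ.≤_) (sym (Fin.toℕ-inject₁ e)) a≤e))) (hop≤ j e)

      -- Induction over the rides: preemption and changes of vehicle do not help, since each ride
      -- obeys the bound in D and time lying at a vertex only delays. The bound on τ settles the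
      -- empty journey, and the vehicle's finishing time renews it after each ride.
      journey≤ : ∀ {u τ w} → Journey route u τ w → τ ≤ makespan I σ → τ + toℚ (D u w) ≤ makespan I σ
      journey≤ arrived τ≤ = ≤-trans rest τ≤
      journey≤ {τ = τ} (ride j a b a<b τ≤ onward) _ =
        ≤-trans (extend τ (stop j a) (≤-trans (+-monoˡ-≤ (toℚ (D (stop j a) (stop j b))) τ≤) (ride≤ j a<b)))
          (journey≤ onward (≤-trans (arrive≤finish j b) (≤-maxℚ finish j)))

    makespan≥K : Girth es → n ℕ.* ℕ.pred K ℕ.< length es → toℚ K ≤ makespan I σ
    makespan≥K girth many with toℚ K ≤? makespan I σ
    ... | yes K≤ = K≤
    ... | no  K≰ = contradiction found λ (i , i∉) →
      let open Unused i (λ j i∈ → i∉ (∈-concat⁺′ i∈ (∈-tabulate⁺ j))) in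
      K≰ (≤-trans (toℚ-mono-≤ (girth i)) (≤-trans (≤-reflexive (sym (+-identityˡ _)))
        (journey≤ (journey i) (maxℚ-nonNeg finish))))
      where
      open DecMembership (Fin._≟_ {length es}) using (_∈?_)
      allUsed : List (Fin (length es))
      allUsed = concat (tabulate used)
      used≤ : ∀ j → length (used j) ℕ.≤ ℕ.pred K
      -- The number of edges is an integer, so a makespan below K leaves at most K - 1 of them per
      -- vehicle.
      used≤ j = ℕ.<⇒≤pred (toℚ-cancel-< {n = K}
        (≤-<-trans (≤-trans (length-used j) (≤-maxℚ finish j)) (≰⇒> K≰)))
      few : length allUsed ℕ.< length es
      few = ℕ.≤-<-trans (length-concat-≤ (tabulate⁺ used≤))
        (subst (λ l → l ℕ.* ℕ.pred K ℕ.< length es) (sym (length-tabulate used)) many)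
      found : ∃[ i ] i ∉ allUsed
      found = Fin.¬∀⟶∃¬ _ _ (_∈? allUsed) λ all∈ → ℕ.<⇒≱ few (covering⇒≤length all∈)

  open NurseStationLocation metric (DialARide.Terminal I) {n} id using (Solution)

  -- Every vertex is a depot, so one-vertex trees already cover all terminals.
  optimum : IsNurseStationOptimum I 0ℚ
  optimum = (trivial , ≤-antisym (maxℚ-lub {n} (λ _ → 0ℚ) ≤-refl (λ _ → ≤-refl)) (maxℚ-nonNeg {n} (λ _ → 0ℚ)))
          , λ S → maxℚ-nonNeg {n} _
    where
    trivial : Solution
    trivial = record
      { F        = λ j → node j []
      ; distinct = λ j → [] ∷ []
      ; rooted   = λ j → refl
      ; covers   = λ v _ → v , here refl
      }

  maxDirect≤1 : maxDirect I ≤ 1ℚ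
  maxDirect≤1 = maxℚ-lub (λ i → toℚ (dist es (tail es i) (head es i))) (toℚ-nonNeg 1)
    λ i → toℚ-mono-≤ (dist-edge es i)

  -- An edge with equal endpoints would violate `Girth`, since its endpoints stay at distance 0 when
  -- it is removed.
  maxDirect>0 : Girth es → 0 ℕ.< length es → 0ℚ < maxDirect I
  maxDirect>0 girth nonempty = <-≤-trans (positive⁻¹ 1ℚ)
    (≤-trans (toℚ-mono-≤ {1} apart) (≤-maxℚ (λ i → toℚ (dist es (tail es i) (head es i))) i))
    where
    i : Fin (length es)
    i = Fin.fromℕ< nonempty
    apart : 0 ℕ.< dist es (tail es i) (head es i)
    apart = ℕ.n≢0⇒n>0 λ d≡0 → ℕ.<⇒≱ (ℕ.>-nonZero⁻¹ K) (ℕ.≤-trans (girth i) (ℕ.≤-reflexive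
      (trans (cong (λ v → dist (removeAt es i) v (head es i)) (dist≡0⇒≡ es d≡0))
             (dist-refl (removeAt es i) (head es i)))))

-- Choice of parameters and the growth rate.

n<2^n : ∀ n → n ℕ.< 2 ℕ.^ n
n<2^n zero    = s≤s z≤n
n<2^n (suc n) = begin-strict
  suc n                      <⟨ s≤s (n<2^n n) ⟩
  1 ℕ.+ 2 ℕ.^ n              ≤⟨ ℕ.+-monoˡ-≤ (2 ℕ.^ n) (ℕ.m^n>0 2 n) ⟩
  2 ℕ.^ n ℕ.+ 2 ℕ.^ n        ≡⟨ cong (2 ℕ.^ n ℕ.+_) (ℕ.+-identityʳ _) ⟨
  2 ℕ.^ suc n                ∎
  where open ℕ.≤-Reasoning

-- The constant of the theorem; the 5 comes from `s≤5Kp`.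
1/5 : ℚ
1/5 = ℤ.+ 1 / 5

scaled-ratio-≤ : ∀ {s k l} .{{_ : ℕ.NonZero l}} → s ℕ.≤ 5 ℕ.* (k ℕ.* l) → 1/5 * (ℤ.+ s / l) ≤ toℚ k
scaled-ratio-≤ {s} {k} {suc l} s≤ = toℚᵘ-cancel-≤ (begin
  toℚᵘ (1/5 * (ℤ.+ s / suc l))               ≃⟨ toℚᵘ-homo-* 1/5 (ℤ.+ s / suc l) ⟩
  toℚᵘ 1/5 ℚᵘ.* toℚᵘ (ℤ.+ s / suc l)         ≃⟨ ℚᵘ.*-congˡ {toℚᵘ 1/5} (toℚᵘ-fromℚᵘ (ℚᵘ.mkℚᵘ (ℤ.+ s) l)) ⟩
  ℚᵘ.mkℚᵘ (ℤ.+ 1 ℤ.* ℤ.+ s) _                ≤⟨ ℚᵘ.*≤* bound ⟩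
  ℚᵘ.mkℚᵘ (ℤ.+ k) 0                          ≃⟨ toℚᵘ∘toℚ k ⟨
  toℚᵘ (toℚ k)                               ∎)
  where
  open ℚᵘ.≤-Reasoning
  bound : (ℤ.+ 1 ℤ.* ℤ.+ s) ℤ.* ℤ.+ 1 ℤ.≤ ℤ.+ k ℤ.* ℤ.+ (5 ℕ.* suc l)
  bound rewrite ℤ.*-identityʳ (ℤ.+ 1 ℤ.* ℤ.+ s) | ℤ.*-identityˡ (ℤ.+ s) | sym (ℤ.pos-* k (5 ℕ.* suc l)) =
    ℤ.+≤+ (ℕ.≤-trans s≤ (ℕ.≤-reflexive (swap k (suc l))))
    where
    swap : ∀ k l → 5 ℕ.* (k ℕ.* l) ≡ k ℕ.* (5 ℕ.* l)
    swap = solve-∀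

gapInstance : ∀ n K .{{_ : ℕ.NonZero n}} .{{_ : ℕ.NonZero K}} →
  2 ℕ.* suc (4 ℕ.* K) ℕ.^ ℕ.pred K ℕ.≤ n →
  Σ[ I ∈ DialARide ] (Uncapacitated I × distinctDepots I ≡ n × IsNurseStationOptimum I 0ℚ ×
    0ℚ < maxDirect I × maxDirect I ≤ 1ℚ × OptimalMakespan≥ I (toℚ K))
gapInstance n K large with es , size , _ , girth ← Relaxation.Greedy.graph {n} K large (n ℕ.* K) ℕ.≤-refl =
  -- The n K edges outnumber the n (K - 1) that n vehicles can use in time below K.
  I , ℕ.≤-refl , distinctDepots≡n , optimum , maxDirect>0 girth nonempty , maxDirect≤1
    , tourSchedule , λ σ → makespan≥K σ girth many
  where
  open Instance {n} {K} es
  many : n ℕ.* ℕ.pred K ℕ.< length es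
  many = begin-strict
    n ℕ.* ℕ.pred K  <⟨ ℕ.*-monoʳ-< n (ℕ.≤-reflexive (ℕ.suc-pred K)) ⟩
    n ℕ.* K         ≡⟨ size ⟨
    length es       ∎
    where open ℕ.≤-Reasoning
  nonempty : 0 ℕ.< length es
  nonempty = ℕ.≤-<-trans z≤n many

module Parameters (p : ℕ) .{{_ : ℕ.NonZero p}} where
  -- n = 2 (8 K)^K, with both n and K powers of 2 so that their logarithms are exact.
  K s n : ℕ
  K = 2 ℕ.^ p
  s = suc ((3 ℕ.+ p) ℕ.* K)
  n = 2 ℕ.^ s

  instance
    K≢0 : ℕ.NonZero K
    K≢0 = ℕ.m^n≢0 2 p

  -- Uses 1 + 4 K ≤ 8 K, which is 2 to the power 3 + p, and raises the exponent from K - 1 to K.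
  large : 2 ℕ.* suc (4 ℕ.* K) ℕ.^ ℕ.pred K ℕ.≤ n
  large = ℕ.*-monoʳ-≤ 2 (begin
    suc (4 ℕ.* K) ℕ.^ ℕ.pred K        ≤⟨ ℕ.^-monoˡ-≤ (ℕ.pred K) 1+4K≤ ⟩
    (2 ℕ.^ (3 ℕ.+ p)) ℕ.^ ℕ.pred K    ≤⟨ ℕ.^-monoʳ-≤ (2 ℕ.^ (3 ℕ.+ p)) {{ℕ.m^n≢0 2 (3 ℕ.+ p)}}
                                           (ℕ.pred[n]≤n {K}) ⟩
    (2 ℕ.^ (3 ℕ.+ p)) ℕ.^ K           ≡⟨ ℕ.^-*-assoc 2 (3 ℕ.+ p) K ⟩
    2 ℕ.^ ((3 ℕ.+ p) ℕ.* K)           ∎)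
    where
    open ℕ.≤-Reasoning
    1+4K≤ : suc (4 ℕ.* K) ℕ.≤ 2 ℕ.^ (3 ℕ.+ p)
    1+4K≤ = begin
      suc (4 ℕ.* K)              ≤⟨ ℕ.+-monoˡ-≤ (4 ℕ.* K) (ℕ.≤-trans (ℕ.m^n>0 2 p) (ℕ.m≤n*m K 4)) ⟩
      4 ℕ.* K ℕ.+ 4 ℕ.* K        ≡⟨ eq K ⟩
      2 ℕ.^ (3 ℕ.+ p)            ∎
      where
      eq : ∀ K → 4 ℕ.* K ℕ.+ 4 ℕ.* K ≡ 2 ℕ.* (2 ℕ.* (2 ℕ.* K))
      eq = solve-∀

  p≤loglog : p ℕ.≤ ⌊log₂ ⌊log₂ n ⌋ ⌋
  p≤loglog = begin
    p                      ≡⟨ ⌊log₂[2^n]⌋≡n p ⟨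
    ⌊log₂ K ⌋              ≤⟨ ⌊log₂⌋-mono-≤ K≤s ⟩
    ⌊log₂ s ⌋              ≡⟨ cong ⌊log₂_⌋ (⌊log₂[2^n]⌋≡n s) ⟨
    ⌊log₂ ⌊log₂ n ⌋ ⌋      ∎
    where
    open ℕ.≤-Reasoning
    K≤s : K ℕ.≤ s
    K≤s = ℕ.≤-trans (ℕ.m≤n*m K (3 ℕ.+ p)) (ℕ.n≤1+n _)

  -- Since p is at least 1, the terms 1, 3 K and K p are at most one, three and one times K p. The
  -- factor 1 in `eq₁` marks where p is substituted.
  s≤5Kp : s ℕ.≤ 5 ℕ.* (K ℕ.* p)
  s≤5Kp = begin
    1 ℕ.+ (3 ℕ.+ p) ℕ.* K                        ≡⟨ eq₁ K p ⟩
    1 ℕ.+ (3 ℕ.* (K ℕ.* 1) ℕ.+ K ℕ.* p)          ≤⟨ ℕ.+-mono-≤ (ℕ.>-nonZero⁻¹ _ {{ℕ.m*n≢0 K p}})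
                                                      (ℕ.+-monoˡ-≤ (K ℕ.* p) (ℕ.*-monoʳ-≤ 3
                                                        (ℕ.*-monoʳ-≤ K (ℕ.>-nonZero⁻¹ p)))) ⟩
    K ℕ.* p ℕ.+ (3 ℕ.* (K ℕ.* p) ℕ.+ K ℕ.* p)    ≡⟨ eq₂ (K ℕ.* p) ⟩
    5 ℕ.* (K ℕ.* p)                              ∎
    where
    open ℕ.≤-Reasoning
    eq₁ : ∀ K p → 1 ℕ.+ (3 ℕ.+ p) ℕ.* K ≡ 1 ℕ.+ (3 ℕ.* (K ℕ.* 1) ℕ.+ K ℕ.* p)
    eq₁ = solve-∀
    eq₂ : ∀ x → x ℕ.+ (3 ℕ.* x ℕ.+ x) ≡ 5 ℕ.* x
    eq₂ = solve-∀

  loglog≢0 : ℕ.NonZero ⌊log₂ ⌊log₂ n ⌋ ⌋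
  loglog≢0 = ℕ.>-nonZero (ℕ.≤-trans (ℕ.>-nonZero⁻¹ p) p≤loglog)

  scaledLogRatio[n]≤K : 1/5 * logRatio n {{loglog≢0}} ≤ toℚ K
  scaledLogRatio[n]≤K = scaled-ratio-≤ {k = K} {{loglog≢0}} (begin
    ⌈log₂ n ⌉                              ≡⟨ ⌈log₂2^n⌉≡n s ⟩
    s                                      ≤⟨ s≤5Kp ⟩
    5 ℕ.* (K ℕ.* p)                        ≤⟨ ℕ.*-monoʳ-≤ 5 (ℕ.*-monoʳ-≤ K p≤loglog) ⟩
    5 ℕ.* (K ℕ.* ⌊log₂ ⌊log₂ n ⌋ ⌋)        ∎)
    where open ℕ.≤-Reasoning

  -- Stated for any t equal to n because the number of distinct depots is n only propositionally; x
  -- stands for the larger of the two lower bounds.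
  scaledLogRatio≤K : ∀ {t x} → t ≡ n → .{{_ : ℕ.NonZero ⌊log₂ ⌊log₂ t ⌋ ⌋}} →
                     0ℚ ≤ x → x ≤ 1ℚ → 1/5 * logRatio t * x ≤ toℚ K
  scaledLogRatio≤K {x = x} refl 0≤x x≤1 = begin
    1/5 * logRatio n * x  ≤⟨ *-monoʳ-≤-nonNeg x {{nonNegative 0≤x}} scaledLogRatio[n]≤K ⟩
    toℚ K * x             ≤⟨ *-monoˡ-≤-nonNeg (toℚ K) {{nonNegative (toℚ-nonNeg K)}} x≤1 ⟩
    toℚ K * 1ℚ            ≡⟨ *-identityʳ (toℚ K) ⟩
    toℚ K                 ∎
    where open ≤-Reasoning

  p≤n : p ℕ.≤ n
  p≤n = begin
    p                      ≤⟨ ℕ.<⇒≤ (n<2^n p) ⟩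
    K                      ≤⟨ ℕ.m≤n*m K (3 ℕ.+ p) ⟩
    (3 ℕ.+ p) ℕ.* K        ≤⟨ ℕ.n≤1+n _ ⟩
    s                      ≤⟨ ℕ.<⇒≤ (n<2^n s) ⟩
    n                      ∎
    where open ℕ.≤-Reasoning

mainTheorem5 : ∃[ c ] (0ℚ < c ×
    ((N : ℕ) →
    Σ[ I ∈ DialARide ] Σ[ nsl ∈ ℚ ]
    Σ[ nz ∈ ℕ.NonZero ⌊log₂ ⌊log₂ distinctDepots I ⌋ ⌋ ]
    ( Uncapacitated I
    × N ℕ.≤ distinctDepots I
    × IsNurseStationOptimum I nsl
    × 0ℚ < maxDirect I ⊔ nsl
    × OptimalMakespan≥ I
    (c * logRatio (distinctDepots I) {{nz}} * (maxDirect I ⊔ nsl)))))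
mainTheorem5 = 1/5 , positive⁻¹ 1/5 , λ N →
  -- The successor makes p nonzero, and p ≤ n then gives more than N depots.
  let open Parameters (suc N)
      I , uncapacitated , depots≡n , optimum , direct>0 , direct≤1 , schedule , makespan≥K =
        gapInstance n K {{ℕ.m^n≢0 2 s}} {{K≢0}} large
      nz = subst (λ t → ℕ.NonZero ⌊log₂ ⌊log₂ t ⌋ ⌋) (sym depots≡n) loglog≢0
      positive = <-≤-trans direct>0 (p≤p⊔q (maxDirect I) 0ℚ)
      bound = scaledLogRatio≤K depots≡n {{nz}} (<⇒≤ positive) (⊔-lub direct≤1 (toℚ-nonNeg 1))
  in I , 0ℚ , nz , uncapacitated
     , subst (N ℕ.≤_) (sym depots≡n) (ℕ.≤-trans (ℕ.n≤1+n N) p≤n)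
     , optimum , positive , schedule , λ σ → ≤-trans bound (makespan≥K σ)
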